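{- Let $N$ be an odd positive integer and $k \ge 2$ such that \[ \sum_{i=0}^{\pi_N(k-1)-1} p_{\le k-1}(i) \equiv 0 \pmod{N}, \] and let $R \in \mathbb{Z}/N\mathbb{Z}$ be arbitrary. Let $Q = \pi'_N(k)$. Then for all integers $n, n' \ge k$ with $n' \equiv n + \pi'_N(k-1) \pmod{Q}$, \[ f_{k,R}(n+Q) - f_{k,R}(n) = f_{k,R}(n'+Q) - f_{k,R}(n'). \] (That is, the slope of the linear function $\mathcal{L}^{(i)}_{k,R}$ equals that of $\mathcal{L}^{(i')}_{k,R}$ whenever $i' \equiv i + \pi'_N(k-1) \pmod{\pi'_N(k)}$, where $f_{k,R}(n) = \mathcal{L}^{(i)}_{k,R}((n-i)/Q)$ for $n\equiv i \pmod Q$.)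
   Context: The Gaussian polynomial is $\begin{bmatrix} n \\ k \end{bmatrix}_q = \frac{[n]!}{[n-k]!\,[k]!}$ with $[m]! = \prod_{i=1}^{m} \frac{1-q^i}{1-q}$, of degree $k(n-k)$. For $n\ge k$, $f_{k,R}(n) = \#\{\alpha \in \{0,\ldots,k(n-k)\} : [q^\alpha]\begin{bmatrix} n \\ k \end{bmatrix}_q \equiv R \pmod N\}$. $p_{\le k}(n)$ is the number of partitions of $n$ with at most $k$ parts; $\pi_N(k)$ is the minimal period of the purely periodic sequence $(p_{\le k}(n) \bmod N)_{n\ge0}$ (so $\pi_N(1)=1$). Define $\pi'_N(1)=1$ and for $k\ge2$: $\pi'_N(k) = \frac{\pi_N(k)}{\pi_N(k-1)}\pi'_N(k-1)$ if $N$ divides $\frac{\pi_N(k)}{\pi_N(k-1)}$, and $\pi'_N(k) = N\frac{\pi_N(k)}{\pi_N(k-1)}\pi'_N(k-1)$ otherwise. For $n \equiv i \pmod Q$ with $0\le i<Q$, $f_{k,R}(n) = \mathcal{L}^{(i)}_{k,R}((n-i)/Q)$ with $\mathcal{L}^{(i)}_{k,R}$ an affine function. -}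

module Defs where

open import Data.Nat using (ℕ; zero; suc; _+_; _*_; _∸_; _≤_; _<_; _≤ᵇ_; NonZero)
open import Data.Nat.DivMod using (_/_; _%_)
open import Data.Nat.Divisibility using (_∣?_)
open import Data.Nat.Properties using (_≟_)
open import Data.Fin using (Fin; toℕ)
open import Data.List using (List; length; filter; upTo; map)
open import Data.Nat.ListAction using (sum)
open import Data.Bool using (if_then_else_)
open import Data.Product using (_×_)
open import Relation.Nullary using (¬_; does)
open import Relation.Binary.PropositionalEquality using (_≡_)

-- Number of partitions of n into at most k parts, each part ≤ m
-- (partitions enumerated as nonincreasing sequences, choosing the largest part j first).
partsBounded : ℕ → ℕ → ℕ → ℕ
partsBounded zero    n       m = if n ≤ᵇ 0 then 1 else 0
partsBounded (suc k) zero    m = 1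
partsBounded (suc k) (suc n) m =
  sum (map (λ j → if (suc j ≤ᵇ m) then partsBounded k (suc n ∸ suc j) (suc j) else 0)
           (upTo (suc n)))

p≤ : ℕ → ℕ → ℕ
p≤ k n = partsBounded k n n

IsMinPeriod : (N : ℕ) → .{{NonZero N}} → ℕ → ℕ → Set
IsMinPeriod N k π =
  (1 ≤ π) ×
  ((∀ n → p≤ k (n + π) % N ≡ p≤ k n % N) ×
   (∀ q → 1 ≤ q → q < π → ¬ (∀ n → p≤ k (n + q) % N ≡ p≤ k n % N)))

-- Gaussian polynomial coefficient [q^α] [n choose k]_q, via the q-Pascal recurrence
-- [n+1, k+1]_q = [n, k]_q + q^(k+1) [n, k+1]_q,  [n,0]_q = 1,  [0,k+1]_q = 0.
gauss : ℕ → ℕ → ℕ → ℕ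
gauss n       zero    α = if α ≤ᵇ 0 then 1 else 0
gauss zero    (suc k) α = 0
gauss (suc n) (suc k) α =
  gauss n k α + (if suc k ≤ᵇ α then gauss n (suc k) (α ∸ suc k) else 0)

f : (N : ℕ) → .{{NonZero N}} → ℕ → Fin N → ℕ → ℕ
f N k R n = length (filter (λ α → gauss n k α % N ≟ toℕ R) (upTo (suc (k * (n ∸ k)))))

-- truncated division (only ever applied when the divisor divides the dividend)
_div_ : ℕ → ℕ → ℕ
m div zero    = 0
m div (suc d) = m / suc d

-- π'_N(k), computed from a given function π with π j = π_N(j).
π′ : ℕ → (ℕ → ℕ) → ℕ → ℕ
π′ N π zero = 1
π′ N π (suc zero) = 1
π′ N π (suc (suc j)) =
  let r = π (suc (suc j)) div π (suc j) in
  if does (N ∣? r) then r * π′ N π (suc j) else N * r * π′ N π (suc j)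

{-# OPTIONS --safe #-}

-- Write n = m + k − 1 and B i l for the coefficient sequence of
-- 1 / (∏_{j ≤ i} (1 − q^j) ∏_{j ≤ l} (1 − q^j)).  By the q-binomial theorem the Gaussian
-- polynomial is Σ_{i + l = k} (−1)^i q^{i m + i(i−1)/2} B i l, and below the exponent
-- (j+1) m + j(j+1)/2 only the summands with i ≤ j matter.  Put M = π′(k−1), Q = π′(k).
-- Modulo N the sequence B 0 k has period Q, and every other B i l has the period M:
-- for i = 1 or l = 1 this is the hypothesis on the partial sums of p_{≤ k−1}; for
-- i, l ≤ k−2 the factors have the common period X = π(k−2), so that B i l (n+X) − B i l n
-- is X-periodic and B i l has period N X, which divides M by the definition of π′.
-- Hence in each of the k windows m ↦ m + Q adds one full period of residues, and
-- m ↦ m + M only rotates that period.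
module Submission where

open import Defs
open import Data.Nat using (ℕ; _+_; _∸_; _≤_; NonZero)
open import Data.Nat.DivMod using (_%_)
open import Data.Fin using (Fin)
open import Data.List using (map; upTo)
open import Data.Nat.ListAction using (sum)
open import Data.Integer using (ℤ; +_; _-_)
open import Data.Integer.Divisibility using (_∣_)
open import Relation.Binary.PropositionalEquality using (_≡_)

open import Data.Nat using (zero; suc; _*_; _<_; _≤ᵇ_; z≤n; s≤s; >-nonZero)
open import Data.Nat.DivMod using (_/_; m≡m%n+[m/n]*n; [m+kn]%n≡m%n; m<n⇒m%n≡m; m%n<n; m*n/n≡m; m*n%n≡0)
import Data.Nat.Divisibility as ℕ
import Data.Nat.Properties as ℕ
open import Data.Integer using (-[1+_]; -_; 0ℤ; 1ℤ; -1ℤ; _^_; _%ℕ_; _/ℕ_; ∣_∣)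
  renaming (_+_ to _⊕_; _*_ to _⊗_)
open import Data.Integer.DivMod using (n%ℕd<d; a≡a%ℕn+[a/ℕn]*n)
import Data.Integer.Properties as ℤ
open import Data.Integer.Tactic.RingSolver using (solve-∀)
open import Algebra.Properties.AbelianGroup ℤ.+-0-abelianGroup using ()
  renaming (∙-cancelˡ to +-cancelˡ; ∙-cancelʳ to +-cancelʳ)
open import Data.Fin using (toℕ)
open import Data.List using (applyUpTo; length; filter)
open import Data.Bool using (true; false; if_then_else_)
open import Data.Empty using (⊥-elim)
open import Data.Product using (_,_; _×_; ∃-syntax; proj₁)
open import Data.Sum using (_⊎_; inj₁; inj₂)
open import Function using (_∘_; id)
open import Relation.Binary.PropositionalEquality using (refl; sym; trans; cong; cong₂; subst; subst₂; module ≡-Reasoning)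
open import Relation.Nullary using (does; yes; no)
open import Relation.Unary using (Decidable)

-- Finite sums and antidiagonal sums.

Σ< : ℕ → (ℕ → ℤ) → ℤ
Σ< zero    g = 0ℤ
Σ< (suc n) g = g 0 ⊕ Σ< n (g ∘ suc)

Σ-cong : ∀ n {g h} → (∀ x → x < n → g x ≡ h x) → Σ< n g ≡ Σ< n h
Σ-cong zero    e = refl
Σ-cong (suc n) e = cong₂ _⊕_ (e 0 (s≤s z≤n)) (Σ-cong n (λ x p → e (suc x) (s≤s p)))

Σ-zero : ∀ n {g} → (∀ x → x < n → g x ≡ 0ℤ) → Σ< n g ≡ 0ℤ
Σ-zero zero    e = refl
Σ-zero (suc n) e = cong₂ _⊕_ (e 0 (s≤s z≤n)) (Σ-zero n (λ x p → e (suc x) (s≤s p)))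

interchange : ∀ a b c d → (a ⊕ b) ⊕ (c ⊕ d) ≡ (a ⊕ c) ⊕ (b ⊕ d)
interchange = solve-∀

Σ-+ : ∀ n g h → Σ< n (λ x → g x ⊕ h x) ≡ Σ< n g ⊕ Σ< n h
Σ-+ zero    g h = refl
Σ-+ (suc n) g h =
  trans (cong (g 0 ⊕ h 0 ⊕_) (Σ-+ n (g ∘ suc) (h ∘ suc)))
        (interchange (g 0) (h 0) (Σ< n (g ∘ suc)) (Σ< n (h ∘ suc)))

Σ-* : ∀ c n g → Σ< n (λ x → c ⊗ g x) ≡ c ⊗ Σ< n g
Σ-* c zero    g = sym (ℤ.*-zeroʳ c)
Σ-* c (suc n) g = trans (cong (c ⊗ g 0 ⊕_) (Σ-* c n (g ∘ suc)))
                        (sym (ℤ.*-distribˡ-+ c (g 0) (Σ< n (g ∘ suc))))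

Σ-split : ∀ a b g → Σ< (a + b) g ≡ Σ< a g ⊕ Σ< b (λ x → g (a + x))
Σ-split zero    b g = sym (ℤ.+-identityˡ _)
Σ-split (suc a) b g = trans (cong (g 0 ⊕_) (Σ-split a b (g ∘ suc)))
                            (sym (ℤ.+-assoc (g 0) (Σ< a (g ∘ suc)) _))

Σ-last : ∀ n g → Σ< (suc n) g ≡ Σ< n g ⊕ g n
Σ-last zero    g = ℤ.+-comm (g 0) 0ℤ
Σ-last (suc n) g = trans (cong (g 0 ⊕_) (Σ-last n (g ∘ suc)))
                         (sym (ℤ.+-assoc (g 0) (Σ< n (g ∘ suc)) _))

+-sum-applyUpTo : ∀ (g φ : ℕ → ℕ) n → + sum (map g (applyUpTo φ n)) ≡ Σ< n (λ x → + g (φ x))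
+-sum-applyUpTo g φ zero    = refl
+-sum-applyUpTo g φ (suc n) =
  trans (ℤ.pos-+ (g (φ 0)) _) (cong (+ g (φ 0) ⊕_) (+-sum-applyUpTo g (φ ∘ suc) n))

-- The sum over i + l = n. It serves both for Cauchy products of coefficient sequences and for the
-- expansion over i + l = k.
anti : (ℕ → ℕ → ℤ) → ℕ → ℤ
anti F n = Σ< (suc n) (λ i → F i (n ∸ i))

anti-cong : ∀ n {F G} → (∀ i l → i + l ≡ n → F i l ≡ G i l) → anti F n ≡ anti G n
anti-cong n e = Σ-cong (suc n) (λ { i (s≤s p) → e i (n ∸ i) (ℕ.m+[n∸m]≡n p) })

anti-cong′ : ∀ n {F G} → (∀ i l → F i l ≡ G i l) → anti F n ≡ anti G n
anti-cong′ n e = anti-cong n (λ i l _ → e i l)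

anti-+ : ∀ n F G → anti (λ i l → F i l ⊕ G i l) n ≡ anti F n ⊕ anti G n
anti-+ n F G = Σ-+ (suc n) (λ i → F i (n ∸ i)) (λ i → G i (n ∸ i))

anti-last : ∀ n F → anti F (suc n) ≡ anti (λ i l → F i (suc l)) n ⊕ F (suc n) 0
anti-last zero    F = regroup (F 0 1) (F 1 0)
  where
  regroup : ∀ a b → a ⊕ (b ⊕ 0ℤ) ≡ (a ⊕ 0ℤ) ⊕ b
  regroup = solve-∀
anti-last (suc n) F =
  trans (cong (F 0 (suc (suc n)) ⊕_) (anti-last n (F ∘ suc)))
        (sym (ℤ.+-assoc (F 0 (suc (suc n))) _ _))

anti-comm : ∀ n F → anti F n ≡ anti (λ i l → F l i) n
anti-comm zero    F = refl
anti-comm (suc n) F = begin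
  F 0 (suc n) ⊕ anti (F ∘ suc) n                ≡⟨ cong (F 0 (suc n) ⊕_) (anti-comm n (F ∘ suc)) ⟩
  F 0 (suc n) ⊕ anti (λ i l → F (suc l) i) n    ≡⟨ ℤ.+-comm (F 0 (suc n)) _ ⟩
  anti (λ i l → F (suc l) i) n ⊕ F 0 (suc n)    ≡⟨ anti-last n (λ i l → F l i) ⟨
  anti (λ i l → F l i) (suc n)                    ∎
  where open ≡-Reasoning

-- Shifts of coefficient sequences.

-- Multiplication of a generating function by q^c.
sh : ℕ → (ℕ → ℤ) → ℕ → ℤ
sh zero    g n       = g n
sh (suc c) g zero    = 0ℤ
sh (suc c) g (suc n) = sh c g n

sh-cong : ∀ c {g h} n → (∀ x → x ≤ n → g x ≡ h x) → sh c g n ≡ sh c h n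
sh-cong zero    n       e = e n ℕ.≤-refl
sh-cong (suc c) zero    e = refl
sh-cong (suc c) (suc n) e = sh-cong c n (λ x p → e x (ℕ.m≤n⇒m≤1+n p))

sh-+ : ∀ c g h n → sh c (λ x → g x ⊕ h x) n ≡ sh c g n ⊕ sh c h n
sh-+ zero    g h n       = refl
sh-+ (suc c) g h zero    = refl
sh-+ (suc c) g h (suc n) = sh-+ c g h n

sh-* : ∀ c s g n → sh c (λ x → s ⊗ g x) n ≡ s ⊗ sh c g n
sh-* zero    s g n       = refl
sh-* (suc c) s g zero    = sym (ℤ.*-zeroʳ s)
sh-* (suc c) s g (suc n) = sh-* c s g n

sh-Σ : ∀ c m (G : ℕ → ℕ → ℤ) n → sh c (λ x → Σ< m (λ i → G i x)) n ≡ Σ< m (λ i → sh c (G i) n)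
sh-Σ zero    m G n       = refl
sh-Σ (suc c) m G zero    = sym (Σ-zero m (λ _ _ → refl))
sh-Σ (suc c) m G (suc n) = sh-Σ c m G n

sh-zero : ∀ c n → sh c (λ _ → 0ℤ) n ≡ 0ℤ
sh-zero zero    n       = refl
sh-zero (suc c) zero    = refl
sh-zero (suc c) (suc n) = sh-zero c n

sh-sh : ∀ a b g n → sh (a + b) g n ≡ sh a (sh b g) n
sh-sh zero    b g n       = refl
sh-sh (suc a) b g zero    = refl
sh-sh (suc a) b g (suc n) = sh-sh a b g n

sh-sh-comm : ∀ a b g n → sh a (sh b g) n ≡ sh b (sh a g) n
sh-sh-comm a b g n = begin
  sh a (sh b g) n ≡⟨ sh-sh a b g n ⟨
  sh (a + b) g n  ≡⟨ cong (λ c → sh c g n) (ℕ.+-comm a b) ⟩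
  sh (b + a) g n  ≡⟨ sh-sh b a g n ⟩
  sh b (sh a g) n ∎
  where open ≡-Reasoning

sh-< : ∀ c g n → n < c → sh c g n ≡ 0ℤ
sh-< (suc c) g zero    _       = refl
sh-< (suc c) g (suc n) (s≤s p) = sh-< c g n p

sh-≥ : ∀ c g n → sh c g (c + n) ≡ g n
sh-≥ zero    g n = refl
sh-≥ (suc c) g n = sh-≥ c g n

sh-if : ∀ c (g : ℕ → ℕ) n → + (if c ≤ᵇ n then g (n ∸ c) else 0) ≡ sh c (λ x → + g x) n
sh-if zero          g n       = refl
sh-if (suc c)       g zero    = refl
-- A separate clause, because `suc c ≤ᵇ n` unfolds to `c <ᵇ n` and not to a recursive call of
-- `_≤ᵇ_`.
sh-if (suc zero)    g (suc n) = refl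
sh-if (suc (suc c)) g (suc n) = sh-if (suc c) g n

-- A positive shift vanishes at `l = 0`, so the last summand drops out and the shift and the total
-- go down by one together.
anti-sh : ∀ c (G : ℕ → ℕ → ℤ) n → anti (λ i l → sh c (G i) l) n ≡ sh c (anti G) n
anti-sh zero    G n       = refl
anti-sh (suc c) G zero    = refl
anti-sh (suc c) G (suc n) =
  trans (anti-last n (λ i l → sh (suc c) (G i) l))
 (trans (ℤ.+-identityʳ (anti (λ i l → sh c (G i) l) n)) (anti-sh c G n))

-- Recurrence for partitions with at most k parts.

-- Removing 1 from each part of a partition with exactly k + 1 parts
-- gives the recurrence in the number of parts.
W : ℕ → ℕ → ℕ → ℤ
W k n m = + partsBounded k n m

-- The guard in `partsBounded`: the index `j` stands for a largest part of size `suc j`.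
θ : ℕ → ℕ → ℤ → ℤ
θ j m z = if suc j ≤ᵇ m then z else 0ℤ

W-suc-suc : ∀ k n m → W (suc k) (suc n) m ≡ anti (λ j t → θ j m (W k t (suc j))) n
W-suc-suc k n m =
  trans (+-sum-applyUpTo (λ j → if suc j ≤ᵇ m then partsBounded k (n ∸ j) (suc j) else 0) id (suc n))
        (Σ-cong (suc n) (λ j _ → +-if j))
  where
  +-if : ∀ j → + (if suc j ≤ᵇ m then partsBounded k (n ∸ j) (suc j) else 0) ≡ θ j m (W k (n ∸ j) (suc j))
  +-if j with suc j ≤ᵇ m
  ... | true  = refl
  ... | false = refl

W-0 : ∀ k m → W k 0 m ≡ 1ℤ
W-0 zero    m = refl
W-0 (suc k) m = refl

W-noParts : ∀ k n → W k (suc n) 0 ≡ 0ℤ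
W-noParts zero    n = refl
W-noParts (suc k) n = trans (W-suc-suc k n 0) (Σ-zero (suc n) (λ _ _ → refl))

-- Here the largest part is `j` itself and may be 0. That value contributes only for `n = 0`, where
-- it accounts for the empty partition.
W-smallest : ∀ k m n → anti (λ j t → θ j (suc m) (W k t j)) n ≡ W (suc k) n m
W-smallest k m zero    = trans (ℤ.+-identityʳ (W k 0 0)) (W-0 k 0)
W-smallest k m (suc n) = begin
  W k (suc n) 0 ⊕ rest                     ≡⟨ cong (_⊕ rest) (W-noParts k n) ⟩
  0ℤ ⊕ rest                                ≡⟨ ℤ.+-identityˡ rest ⟩
  rest                                       ≡⟨ W-suc-suc k n m ⟨
  W (suc k) (suc n) m                        ∎
  where
  open ≡-Reasoning
  rest = anti (λ j t → θ j m (W k t (suc j))) n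

W-rec : ∀ k n m → W (suc k) n (suc m) ≡ W k n (suc m) ⊕ sh (suc k) (λ x → W (suc k) x m) n
W-rec zero    zero    m = refl
W-rec (suc k) zero    m = refl
W-rec zero    (suc n) m = begin
  W 1 (suc n) (suc m)                          ≡⟨ W-suc-suc 0 n (suc m) ⟩
  anti (λ j t → θ j (suc m) (W 0 t j)) n       ≡⟨ W-smallest 0 m n ⟩
  W 1 n m                                      ≡⟨ ℤ.+-identityˡ _ ⟨
  0ℤ ⊕ W 1 n m                               ∎
  where open ≡-Reasoning
W-rec (suc k) (suc n) m = begin
  W (suc (suc k)) (suc n) (suc m)
    ≡⟨ W-suc-suc (suc k) n (suc m) ⟩
  anti (λ j t → θ j (suc m) (W (suc k) t (suc j))) n
    ≡⟨ anti-cong′ n (λ j t → trans (cong (θ j (suc m)) (W-rec k t j)) (θ-+ j (W k t (suc j)) (sh (suc k) (λ x → W (suc k) x j) t))) ⟩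
  anti (λ j t → θ j (suc m) (W k t (suc j)) ⊕ θ j (suc m) (sh (suc k) (λ x → W (suc k) x j) t)) n
    ≡⟨ anti-+ n (λ j t → θ j (suc m) (W k t (suc j)))
              (λ j t → θ j (suc m) (sh (suc k) (λ x → W (suc k) x j) t)) ⟩
  anti (λ j t → θ j (suc m) (W k t (suc j))) n
    ⊕ anti (λ j t → θ j (suc m) (sh (suc k) (λ x → W (suc k) x j) t)) n
    ≡⟨ cong₂ _⊕_ (sym (W-suc-suc k n (suc m))) (anti-cong′ n (λ j t → θ-sh j t)) ⟩
  W (suc k) (suc n) (suc m) ⊕ anti (λ j t → sh (suc k) (λ x → θ j (suc m) (W (suc k) x j)) t) n
    ≡⟨ cong (W (suc k) (suc n) (suc m) ⊕_) (anti-sh (suc k) (λ j x → θ j (suc m) (W (suc k) x j)) n) ⟩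
  W (suc k) (suc n) (suc m) ⊕ sh (suc k) (anti (λ j x → θ j (suc m) (W (suc k) x j))) n
    -- The inductive hypothesis lowered the other `suc k` parts by 1. The largest part is lowered by
    -- passing from `suc n` to `n`, so `sh (suc k)` at `n` is `sh (suc (suc k))` at `suc n`.
    ≡⟨ cong (W (suc k) (suc n) (suc m) ⊕_) (sh-cong (suc k) n (λ x _ → W-smallest (suc k) m x)) ⟩
  W (suc k) (suc n) (suc m) ⊕ sh (suc k) (λ x → W (suc (suc k)) x m) n
    ∎
  where
  open ≡-Reasoning
  θ-+ : ∀ j a b → θ j (suc m) (a ⊕ b) ≡ θ j (suc m) a ⊕ θ j (suc m) b
  θ-+ j a b with suc j ≤ᵇ suc m
  ... | true  = refl
  ... | false = refl
  θ-sh : ∀ j t → θ j (suc m) (sh (suc k) (λ x → W (suc k) x j) t)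
               ≡ sh (suc k) (λ x → θ j (suc m) (W (suc k) x j)) t
  θ-sh j t with suc j ≤ᵇ suc m
  ... | true  = refl
  ... | false = sym (sh-zero (suc k) t)

P : ℕ → ℕ → ℤ
P k n = + p≤ k n

W-stable : ∀ k n m → n ≤ m → W k n m ≡ P k n
W-stable zero    n       m _ = refl
W-stable (suc k) zero    m _ = refl
W-stable (suc k) (suc n) m n<m =
  trans (W-suc-suc k n m) (trans (Σ-cong (suc n) λ j j≤n → same j j≤n) (sym (W-suc-suc k n (suc n))))
  where
  θ-true : ∀ j m z → j < m → θ j m z ≡ z
  θ-true j m z p with suc j ≤ᵇ m | ℕ.≤⇒≤ᵇ p
  ... | true | _ = refl
  same : ∀ j → j < suc n → θ j m (W k (n ∸ j) (suc j)) ≡ θ j (suc n) (W k (n ∸ j) (suc j))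
  same j p = trans (θ-true j m _ (ℕ.≤-trans p n<m)) (sym (θ-true j (suc n) _ p))

P-rec : ∀ k n → P (suc k) n ≡ P k n ⊕ sh (suc k) (P (suc k)) n
P-rec k zero    = sym (trans (ℤ.+-identityʳ (P k 0)) (W-0 k 0))
P-rec k (suc n) = trans (W-rec k (suc n) n)
  -- The shift only reads arguments up to `n`, where the bound `n` on the parts is void.
  (cong (P k (suc n) ⊕_) (sh-cong k n (λ x x≤n → W-stable (suc k) x n x≤n)))

-- Products of two partition series.

B : ℕ → ℕ → ℕ → ℤ
B i l n = anti (λ s t → P i s ⊗ P l t) n

-- The factor 1 - q^(l+1) cancels in the second series by `P-rec`; `anti-sh` pulls the shift out of
-- the product.
B-recʳ : ∀ i l n → B i (suc l) n ≡ B i l n ⊕ sh (suc l) (B i (suc l)) n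
B-recʳ i l n = begin
  anti (λ s t → P i s ⊗ P (suc l) t) n
    ≡⟨ anti-cong′ n (λ s t → step s t) ⟩
  anti (λ s t → P i s ⊗ P l t ⊕ sh (suc l) (λ x → P i s ⊗ P (suc l) x) t) n
    ≡⟨ anti-+ n (λ s t → P i s ⊗ P l t) (λ s t → sh (suc l) (λ x → P i s ⊗ P (suc l) x) t) ⟩
  B i l n ⊕ anti (λ s t → sh (suc l) (λ x → P i s ⊗ P (suc l) x) t) n
    ≡⟨ cong (B i l n ⊕_) (anti-sh (suc l) (λ s x → P i s ⊗ P (suc l) x) n) ⟩
  B i l n ⊕ sh (suc l) (B i (suc l)) n
    ∎
  where
  open ≡-Reasoning
  step : ∀ s t → P i s ⊗ P (suc l) t ≡ P i s ⊗ P l t ⊕ sh (suc l) (λ x → P i s ⊗ P (suc l) x) t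
  step s t = begin
    P i s ⊗ P (suc l) t
      ≡⟨ cong (P i s ⊗_) (P-rec l t) ⟩
    P i s ⊗ (P l t ⊕ sh (suc l) (P (suc l)) t)
      ≡⟨ ℤ.*-distribˡ-+ (P i s) (P l t) _ ⟩
    P i s ⊗ P l t ⊕ P i s ⊗ sh (suc l) (P (suc l)) t
      ≡⟨ cong (P i s ⊗ P l t ⊕_) (sh-* (suc l) (P i s) (P (suc l)) t) ⟨
    P i s ⊗ P l t ⊕ sh (suc l) (λ x → P i s ⊗ P (suc l) x) t
      ∎

B-comm : ∀ i l n → B i l n ≡ B l i n
B-comm i l n = trans (anti-comm n (λ s t → P i s ⊗ P l t))
                     (anti-cong′ n (λ s t → ℤ.*-comm (P i t) (P l s)))

B-recˡ : ∀ i l n → B (suc i) l n ≡ B i l n ⊕ sh (suc i) (B (suc i) l) n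
B-recˡ i l n = begin
  B (suc i) l n                            ≡⟨ B-comm (suc i) l n ⟩
  B l (suc i) n                            ≡⟨ B-recʳ l i n ⟩
  B l i n ⊕ sh (suc i) (B l (suc i)) n     ≡⟨ cong₂ _⊕_ (B-comm l i n) (sh-cong (suc i) n (λ x _ → B-comm l (suc i) x)) ⟩
  B i l n ⊕ sh (suc i) (B (suc i) l) n     ∎
  where open ≡-Reasoning

B-0 : ∀ l n → B 0 l n ≡ P l n
B-0 l n = trans (cong₂ _⊕_ (ℤ.*-identityˡ (P l n)) (Σ-zero n (λ s _ → ℤ.*-zeroˡ (P l (n ∸ suc s)))))
                (ℤ.+-identityʳ (P l n))

-- The q-binomial expansion and its q-Pascal recurrence.

tri : ℕ → ℕ
tri zero    = 0
tri (suc i) = tri i + i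

-- The lowest exponent of q in the summand of index `i`; `tri i` is i(i-1)/2.
σ : ℕ → ℕ → ℕ
σ i m = i * m + tri i

σ-suc : ∀ i m → σ i (suc m) ≡ i + σ i m
σ-suc i m = trans (cong (_+ tri i) (ℕ.*-suc i m)) (ℕ.+-assoc i (i * m) (tri i))

σ-0 : ∀ i → σ i 0 ≡ tri i
σ-0 i = cong (_+ tri i) (ℕ.*-zeroʳ i)

-- The summands of ∏_{i ≤ k} (1 − q^{n−k+i}) / ∏_{i ≤ k} (1 − q^i), expanded by
-- the q-binomial theorem; here m = n − k + 1 and l = k − i.
term : ℕ → ℕ → ℕ → ℕ → ℤ
term i l m α = (-1ℤ ^ i) ⊗ sh (σ i m) (B i l) α

H : ℕ → ℕ → ℕ → ℤ
H k m α = anti (λ i l → term i l m α) k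

sh-H : ∀ c k m α → sh c (H k m) α ≡ anti (λ i l → (-1ℤ ^ i) ⊗ sh c (sh (σ i m) (B i l)) α) k
sh-H c k m α =
  trans (sh-Σ c (suc k) (λ i → term i (k ∸ i) m) α)
        (anti-cong′ k (λ i l → sh-* c (-1ℤ ^ i) (sh (σ i m) (B i l)) α))

-- Of the factor q^(i+l), the part q^i raises `m` by one in the exponent, and q^l is left over for
-- `B-recʳ`.
sh-term : ∀ i l m α → (-1ℤ ^ i) ⊗ sh (i + l) (sh (σ i m) (B i l)) α ≡ (-1ℤ ^ i) ⊗ sh (σ i (suc m)) (sh l (B i l)) α
sh-term i l m α = cong ((-1ℤ ^ i) ⊗_) (begin
  sh (i + l) (sh (σ i m) (B i l)) α      ≡⟨ sh-sh (i + l) (σ i m) (B i l) α ⟨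
  sh (i + l + σ i m) (B i l) α           ≡⟨ cong (λ c → sh c (B i l) α) (swap i l (σ i m)) ⟩
  sh (i + σ i m + l) (B i l) α           ≡⟨ cong (λ c → sh (c + l) (B i l) α) (σ-suc i m) ⟨
  sh (σ i (suc m) + l) (B i l) α         ≡⟨ sh-sh (σ i (suc m)) l (B i l) α ⟩
  sh (σ i (suc m)) (sh l (B i l)) α      ∎)
  where
  open ≡-Reasoning
  swap : ∀ a b c → a + b + c ≡ a + c + b
  swap a b c = trans (ℕ.+-assoc a b c) (trans (cong (λ x → a + x) (ℕ.+-comm b c)) (sym (ℕ.+-assoc a c b)))

term-pascal : ∀ i l m α → term i (suc l) m α ≡ term i l m α ⊕ (-1ℤ ^ i) ⊗ sh (σ i m) (sh (suc l) (B i (suc l))) α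
term-pascal i l m α = begin
  s ⊗ sh (σ i m) (B i (suc l)) α
    ≡⟨ cong (s ⊗_) (sh-cong (σ i m) α (λ x _ → B-recʳ i l x)) ⟩
  s ⊗ sh (σ i m) (λ x → B i l x ⊕ sh (suc l) (B i (suc l)) x) α
    ≡⟨ cong (s ⊗_) (sh-+ (σ i m) (B i l) (sh (suc l) (B i (suc l))) α) ⟩
  s ⊗ (sh (σ i m) (B i l) α ⊕ sh (σ i m) (sh (suc l) (B i (suc l))) α)
    ≡⟨ ℤ.*-distribˡ-+ s (sh (σ i m) (B i l) α) _ ⟩
  term i l m α ⊕ s ⊗ sh (σ i m) (sh (suc l) (B i (suc l))) α
    ∎
  where
  open ≡-Reasoning
  s = -1ℤ ^ i

-- For positive `l`, `term-pascal` splits each summand into one of `H k (suc m)` and one carrying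
-- q^l. The summand with `l = 0` is not split: its shift by `l` is empty, so it completes the second
-- sum as it stands.
H-pascal : ∀ k m α → H (suc k) (suc m) α ≡ H k (suc m) α ⊕ sh (suc k) (H (suc k) m) α
H-pascal k m α = begin
  H (suc k) (suc m) α
    ≡⟨ anti-last k (λ i l → term i l (suc m) α) ⟩
  anti (λ i l → term i (suc l) (suc m) α) k ⊕ e (suc k) 0
    ≡⟨ cong (_⊕ e (suc k) 0) (anti-cong′ k (λ i l → term-pascal i l (suc m) α)) ⟩
  anti (λ i l → term i l (suc m) α ⊕ e i (suc l)) k ⊕ e (suc k) 0
    ≡⟨ cong (_⊕ e (suc k) 0) (anti-+ k (λ i l → term i l (suc m) α) (λ i l → e i (suc l))) ⟩
  H k (suc m) α ⊕ anti (λ i l → e i (suc l)) k ⊕ e (suc k) 0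
    ≡⟨ ℤ.+-assoc (H k (suc m) α) _ (e (suc k) 0) ⟩
  H k (suc m) α ⊕ (anti (λ i l → e i (suc l)) k ⊕ e (suc k) 0)
    ≡⟨ cong (H k (suc m) α ⊕_) (anti-last k e) ⟨
  H k (suc m) α ⊕ anti e (suc k)
    ≡⟨ cong (H k (suc m) α ⊕_) (anti-cong (suc k) (λ i l i+l≡ →
         trans (cong (λ c → (-1ℤ ^ i) ⊗ sh c (sh (σ i m) (B i l)) α) (sym i+l≡)) (sh-term i l m α))) ⟨
  H k (suc m) α ⊕ anti (λ i l → (-1ℤ ^ i) ⊗ sh (suc k) (sh (σ i m) (B i l)) α) (suc k)
    ≡⟨ cong (H k (suc m) α ⊕_) (sh-H (suc k) (suc k) m α) ⟨
  H k (suc m) α ⊕ sh (suc k) (H (suc k) m) α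
    ∎
  where
  open ≡-Reasoning
  e : ℕ → ℕ → ℤ
  e i l = (-1ℤ ^ i) ⊗ sh (σ i (suc m)) (sh l (B i l)) α

-- Vanishing of the expansion at m = 0.

-- (1 − q^i) B i l and (1 − q^l) B i l.
Bˡ : ℕ → ℕ → ℕ → ℤ
Bˡ zero    l n = 0ℤ
Bˡ (suc i) l n = B i l n

Bʳ : ℕ → ℕ → ℕ → ℤ
Bʳ i zero    n = 0ℤ
Bʳ i (suc l) n = B i l n

B-Bˡ : ∀ i l n → B i l n ≡ Bˡ i l n ⊕ sh i (B i l) n
B-Bˡ zero    l n = sym (ℤ.+-identityˡ (B 0 l n))
B-Bˡ (suc i) l n = B-recˡ i l n

B-Bʳ : ∀ i l n → B i l n ≡ Bʳ i l n ⊕ sh l (B i l) n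
B-Bʳ i zero    n = sym (ℤ.+-identityˡ (B i 0 n))
B-Bʳ i (suc l) n = B-recʳ i l n

-- 1 − q^{i+l} = (1 − q^l) + q^l (1 − q^i).
B-split : ∀ i l n → B i l n ≡ Bʳ i l n ⊕ sh l (Bˡ i l) n ⊕ sh (i + l) (B i l) n
B-split i l n = begin
  B i l n
    ≡⟨ B-Bʳ i l n ⟩
  Bʳ i l n ⊕ sh l (B i l) n
    ≡⟨ cong (Bʳ i l n ⊕_) (sh-cong l n (λ x _ → B-Bˡ i l x)) ⟩
  Bʳ i l n ⊕ sh l (λ x → Bˡ i l x ⊕ sh i (B i l) x) n
    ≡⟨ cong (Bʳ i l n ⊕_) (sh-+ l (Bˡ i l) (sh i (B i l)) n) ⟩
  Bʳ i l n ⊕ (sh l (Bˡ i l) n ⊕ sh l (sh i (B i l)) n)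
    ≡⟨ ℤ.+-assoc (Bʳ i l n) _ _ ⟨
  Bʳ i l n ⊕ sh l (Bˡ i l) n ⊕ sh l (sh i (B i l)) n
    ≡⟨ cong (Bʳ i l n ⊕ sh l (Bˡ i l) n ⊕_) (trans (sh-sh-comm l i (B i l) n) (sym (sh-sh i l (B i l) n))) ⟩
  Bʳ i l n ⊕ sh l (Bˡ i l) n ⊕ sh (i + l) (B i l) n
    ∎
  where open ≡-Reasoning

-- At m = 0 the product ∏ (1 - q^(m+i-1)) contains the factor 1 - q^0, so the sum must vanish for k
-- ≥ 1. This is the base case for the comparison with `gauss`.
T : ℕ → ℕ → ℤ
T k = H k 0

-- `B-split` cuts each summand in three: lowering `l` gives `T k`, lowering `i` gives -q^k `T k`,
-- and the rest is q^(k+1) `T (suc k)`. Negative terms are moved to the other side.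
T-step : ∀ k α → T (suc k) α ⊕ sh k (T k) α ≡ T k α ⊕ sh (suc k) (T (suc k)) α
T-step k α = begin
  T (suc k) α ⊕ z
    ≡⟨ cong (_⊕ z) (anti-cong (suc k) (λ i l i+l≡ → split i l (suc k) i+l≡)) ⟩
  anti (λ i l → a i l ⊕ b i l ⊕ c i l) (suc k) ⊕ z
    ≡⟨ cong (_⊕ z) (trans (anti-+ (suc k) (λ i l → a i l ⊕ b i l) c) (cong (_⊕ anti c (suc k)) (anti-+ (suc k) a b))) ⟩
  anti a (suc k) ⊕ anti b (suc k) ⊕ anti c (suc k) ⊕ z
    ≡⟨ cong (_⊕ z) (cong₂ _⊕_ (cong₂ _⊕_ a-sum b-sum) (sym (sh-H (suc k) (suc k) 0 α))) ⟩
  T k α ⊕ -1ℤ ⊗ z ⊕ sh (suc k) (T (suc k)) α ⊕ z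
    ≡⟨ cancel (T k α) z (sh (suc k) (T (suc k)) α) ⟩
  T k α ⊕ sh (suc k) (T (suc k)) α
    ∎
  where
  open ≡-Reasoning
  z = sh k (T k) α
  a b c : ℕ → ℕ → ℤ
  a i l = (-1ℤ ^ i) ⊗ sh (σ i 0) (Bʳ i l) α
  b i l = (-1ℤ ^ i) ⊗ sh (σ i 0) (sh l (Bˡ i l)) α
  c i l = (-1ℤ ^ i) ⊗ sh (suc k) (sh (σ i 0) (B i l)) α
  cancel : ∀ x y w → x ⊕ -1ℤ ⊗ y ⊕ w ⊕ y ≡ x ⊕ w
  cancel = solve-∀
  distrib₃ : ∀ s x y w → s ⊗ (x ⊕ y ⊕ w) ≡ s ⊗ x ⊕ s ⊗ y ⊕ s ⊗ w
  distrib₃ = solve-∀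
  split : ∀ i l K → i + l ≡ K → term i l 0 α ≡ a i l ⊕ b i l ⊕ (-1ℤ ^ i) ⊗ sh K (sh (σ i 0) (B i l)) α
  split i l .(i + l) refl = begin
    s ⊗ sh S (B i l) α
      ≡⟨ cong (s ⊗_) (sh-cong S α (λ x _ → B-split i l x)) ⟩
    s ⊗ sh S (λ x → Bʳ i l x ⊕ sh l (Bˡ i l) x ⊕ sh (i + l) (B i l) x) α
      ≡⟨ cong (s ⊗_) (trans (sh-+ S (λ x → Bʳ i l x ⊕ sh l (Bˡ i l) x) (sh (i + l) (B i l)) α)
           (cong (_⊕ sh S (sh (i + l) (B i l)) α) (sh-+ S (Bʳ i l) (sh l (Bˡ i l)) α))) ⟩
    s ⊗ (sh S (Bʳ i l) α ⊕ sh S (sh l (Bˡ i l)) α ⊕ sh S (sh (i + l) (B i l)) α)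
      ≡⟨ distrib₃ s (sh S (Bʳ i l) α) (sh S (sh l (Bˡ i l)) α) _ ⟩
    a i l ⊕ b i l ⊕ s ⊗ sh S (sh (i + l) (B i l)) α
      ≡⟨ cong (λ w → a i l ⊕ b i l ⊕ s ⊗ w) (sh-sh-comm S (i + l) (B i l) α) ⟩
    a i l ⊕ b i l ⊕ s ⊗ sh (i + l) (sh S (B i l)) α
      ∎
    where
    s = -1ℤ ^ i
    S = σ i 0
  a-sum : anti a (suc k) ≡ T k α
  a-sum = begin
    anti a (suc k)                       ≡⟨ anti-last k a ⟩
    T k α ⊕ (-1ℤ ^ suc k) ⊗ sh (σ (suc k) 0) (λ _ → 0ℤ) α
      ≡⟨ cong (λ w → T k α ⊕ (-1ℤ ^ suc k) ⊗ w) (sh-zero (σ (suc k) 0) α) ⟩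
    T k α ⊕ (-1ℤ ^ suc k) ⊗ 0ℤ            ≡⟨ cong (T k α ⊕_) (ℤ.*-zeroʳ (-1ℤ ^ suc k)) ⟩
    T k α ⊕ 0ℤ                           ≡⟨ ℤ.+-identityʳ (T k α) ⟩
    T k α                                ∎
  -- Reindexing from `suc i` to `i` costs a sign, and the exponent is
  -- `tri (suc i) + l = (i + l) + tri i`.
  b-suc : ∀ i l K → i + l ≡ K → b (suc i) l ≡ -1ℤ ⊗ ((-1ℤ ^ i) ⊗ sh K (sh (σ i 0) (B i l)) α)
  b-suc i l .(i + l) refl = begin
    (-1ℤ ⊗ (-1ℤ ^ i)) ⊗ sh (σ (suc i) 0) (sh l (B i l)) α
      ≡⟨ ℤ.*-assoc -1ℤ (-1ℤ ^ i) _ ⟩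
    -1ℤ ⊗ ((-1ℤ ^ i) ⊗ sh (σ (suc i) 0) (sh l (B i l)) α)
      ≡⟨ cong (λ w → -1ℤ ⊗ ((-1ℤ ^ i) ⊗ w)) shift ⟩
    -1ℤ ⊗ ((-1ℤ ^ i) ⊗ sh (i + l) (sh (σ i 0) (B i l)) α)
      ∎
    where
    shift : sh (σ (suc i) 0) (sh l (B i l)) α ≡ sh (i + l) (sh (σ i 0) (B i l)) α
    shift = begin
      sh (σ (suc i) 0) (sh l (B i l)) α  ≡⟨ sh-sh (σ (suc i) 0) l (B i l) α ⟨
      sh (σ (suc i) 0 + l) (B i l) α     ≡⟨ cong (λ d → sh d (B i l) α) exponent ⟩
      sh (i + l + σ i 0) (B i l) α       ≡⟨ sh-sh (i + l) (σ i 0) (B i l) α ⟩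
      sh (i + l) (sh (σ i 0) (B i l)) α  ∎
      where
      exponent : σ (suc i) 0 + l ≡ i + l + σ i 0
      exponent = begin
        σ (suc i) 0 + l   ≡⟨ cong (_+ l) (σ-0 (suc i)) ⟩
        tri i + i + l     ≡⟨ ℕ.+-assoc (tri i) i l ⟩
        tri i + (i + l)   ≡⟨ ℕ.+-comm (tri i) (i + l) ⟩
        i + l + tri i     ≡⟨ cong (λ d → i + l + d) (σ-0 i) ⟨
        i + l + σ i 0     ∎
  b-zero : ∀ l → b 0 l ≡ 0ℤ
  b-zero l = trans (ℤ.*-identityˡ (sh l (λ _ → 0ℤ) α)) (sh-zero l α)
  b-sum : anti b (suc k) ≡ -1ℤ ⊗ z
  b-sum = begin
    b 0 (suc k) ⊕ anti (λ i l → b (suc i) l) k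
      ≡⟨ cong₂ _⊕_ (b-zero (suc k)) (anti-cong k (λ i l i+l≡ → b-suc i l k i+l≡)) ⟩
    0ℤ ⊕ anti (λ i l → -1ℤ ⊗ ((-1ℤ ^ i) ⊗ sh k (sh (σ i 0) (B i l)) α)) k
      ≡⟨ ℤ.+-identityˡ _ ⟩
    anti (λ i l → -1ℤ ⊗ ((-1ℤ ^ i) ⊗ sh k (sh (σ i 0) (B i l)) α)) k
      ≡⟨ Σ-* -1ℤ (suc k) (λ i → (-1ℤ ^ i) ⊗ sh k (sh (σ i 0) (B i (k ∸ i))) α) ⟩
    -1ℤ ⊗ anti (λ i l → (-1ℤ ^ i) ⊗ sh k (sh (σ i 0) (B i l)) α) k
      ≡⟨ cong (-1ℤ ⊗_) (sh-H k k 0 α) ⟨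
    -1ℤ ⊗ z
      ∎

-- A positive shift reads only smaller indices, so strong induction applies.
sh-fixed⇒0 : ∀ k (g : ℕ → ℤ) → (∀ n → g n ≡ sh (suc k) g n) → ∀ n → g n ≡ 0ℤ
sh-fixed⇒0 k g fixed n = below (suc n) n ℕ.≤-refl
  where
  below : ∀ b n → n < b → g n ≡ 0ℤ
  below (suc b) zero    _         = fixed 0
  below (suc b) (suc n) (s≤s n<b) = trans (fixed (suc n))
    (trans (sh-cong k n (λ x x≤n → below b x (ℕ.≤-trans (s≤s x≤n) n<b))) (sh-zero k n))

-- `T-step` carries (1 - q^k) `T k` = 0 from k to k + 1; at k = 0 the factor is 1 - q^0.
T-fixed : ∀ k α → T k α ≡ sh k (T k) α
T-fixed zero    α = refl
T-fixed (suc k) α = +-cancelˡ (T k α) _ _ (begin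
  T k α ⊕ T (suc k) α              ≡⟨ cong (_⊕ T (suc k) α) (T-fixed k α) ⟩
  sh k (T k) α ⊕ T (suc k) α       ≡⟨ ℤ.+-comm (sh k (T k) α) (T (suc k) α) ⟩
  T (suc k) α ⊕ sh k (T k) α       ≡⟨ T-step k α ⟩
  T k α ⊕ sh (suc k) (T (suc k)) α ∎)
  where open ≡-Reasoning

T-suc : ∀ k α → T (suc k) α ≡ 0ℤ
T-suc k = sh-fixed⇒0 k (T (suc k)) (T-fixed (suc k))

-- Identification with the Gaussian coefficients.

G : ℕ → ℕ → ℕ → ℤ
G n k α = + gauss n k α

G-pascal : ∀ n k α → G (suc n) (suc k) α ≡ G n k α ⊕ sh (suc k) (G n (suc k)) α
G-pascal n k α = trans (ℤ.pos-+ (gauss n k α) _) (cong (G n k α ⊕_) (sh-if (suc k) (gauss n (suc k)) α))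

G-< : ∀ n k α → n < k → G n k α ≡ 0ℤ
G-< zero    (suc k) α _         = refl
G-< (suc n) (suc k) α (s≤s n<k) = trans (G-pascal n k α)
  (cong₂ _⊕_ (G-< n k α n<k)
     (trans (sh-cong (suc k) α (λ x _ → G-< n (suc k) x (ℕ.m≤n⇒m≤1+n n<k))) (sh-zero (suc k) α)))

G-0 : ∀ n m α → G n 0 α ≡ H 0 m α
G-0 n m zero    = refl
G-0 n m (suc α) = sym (trans (ℤ.+-identityʳ _) (trans (ℤ.*-identityˡ _) (B-0 0 (suc α))))

-- Both sides obey the same q-Pascal recurrence. This form starts at `m = 0`, where the upper index
-- is below the lower one and both sides vanish by `G-<` and `T-suc`.
G-H′ : ∀ k m α → G (m + k) (suc k) α ≡ H (suc k) m α
G-H  : ∀ k m α → G (m + k) k α ≡ H k (suc m) α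

G-H zero    m α = G-0 (m + 0) (suc m) α
G-H (suc k) m α = trans (cong (λ n → G n (suc k) α) (ℕ.+-suc m k)) (G-H′ k (suc m) α)

G-H′ k zero    α = trans (G-< k (suc k) α ℕ.≤-refl) (sym (T-suc k α))
G-H′ k (suc m) α = begin
  G (suc (m + k)) (suc k) α
    ≡⟨ G-pascal (m + k) k α ⟩
  G (m + k) k α ⊕ sh (suc k) (G (m + k) (suc k)) α
    ≡⟨ cong₂ _⊕_ (G-H k m α) (sh-cong (suc k) α (λ x _ → G-H′ k m x)) ⟩
  H k (suc m) α ⊕ sh (suc k) (H (suc k) m) α
    ≡⟨ H-pascal k m α ⟨
  H (suc k) (suc m) α
    ∎
  where open ≡-Reasoning

-- In the q-Pascal recurrence the summands have degree at most k(m+1) and (k+1) + (k+1)m, both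
-- within (k+1)(m+1).
G-degree : ∀ k m α → k * m < α → G (m + k) k α ≡ 0ℤ
G-degree zero    zero    (suc α) _ = refl
G-degree zero    (suc m) (suc α) _ = refl
G-degree (suc k) zero    α       p = trans (G-pascal k k α)
  (cong₂ _⊕_ (G-degree k 0 α p)
    (trans (sh-cong (suc k) α (λ x _ → G-< k (suc k) x ℕ.≤-refl)) (sh-zero (suc k) α)))
G-degree (suc k) (suc m) α       p = begin
  G (suc (m + suc k)) (suc k) α
    ≡⟨ G-pascal (m + suc k) k α ⟩
  G (m + suc k) k α ⊕ sh (suc k) (G (m + suc k) (suc k)) α
    ≡⟨ cong₂ _⊕_ (trans (cong (λ n → G n k α) (ℕ.+-suc m k)) (G-degree k (suc m) α (ℕ.≤-trans (s≤s (ℕ.m≤n+m _ (suc m))) p)))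
                 (tail α p) ⟩
  0ℤ
    ∎
  where
  open ≡-Reasoning
  tail : ∀ α → suc k * suc m < α → sh (suc k) (G (m + suc k) (suc k)) α ≡ 0ℤ
  tail α p with ℕ.m≤n⇒∃[o]m+o≡n (ℕ.≤-trans (ℕ.m≤m*n (suc k) (suc m)) (ℕ.<⇒≤ p))
  ... | y , refl = trans (sh-≥ (suc k) (G (m + suc k) (suc k)) y)
    (G-degree (suc k) m y (ℕ.+-cancelˡ-< (suc k) _ _ (subst (_< suc k + y) (ℕ.*-suc (suc k) m) p)))

-- Partial sums, exponents and rotation of a period.

P-1 : ∀ n → P 1 n ≡ 1ℤ
P-1 zero    = refl
P-1 (suc n) = trans (P-rec 0 (suc n)) (trans (ℤ.+-identityˡ (P 1 n)) (P-1 n))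

-- Multiplication by 1/(1 - q) takes partial sums; this is how the hypothesis on the sum of p_{≤
-- k-1} enters.
B-1 : ∀ l n → B 1 l n ≡ Σ< (suc n) (P l)
B-1 l n = trans (anti-cong′ n (λ s t → trans (cong (_⊗ P l t) (P-1 s)) (ℤ.*-identityˡ (P l t))))
                (anti-comm n (λ _ t → P l t))

-- The part of the sum over s + t = a + n with t < a.
tail : (ℕ → ℕ → ℤ) → ℕ → ℕ → ℤ
tail F zero    n = 0ℤ
tail F (suc a) n = tail (λ s t → F s (suc t)) a n ⊕ F (suc (a + n)) 0

anti-split : ∀ a F n → anti F (a + n) ≡ anti (λ s t → F s (a + t)) n ⊕ tail F a n
anti-split zero    F n = sym (ℤ.+-identityʳ (anti F n))
anti-split (suc a) F n =
  trans (anti-last (a + n) F)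
 (trans (cong (_⊕ F (suc (a + n)) 0) (anti-split a (λ s t → F s (suc t)) n))
        (ℤ.+-assoc (anti (λ s t → F s (suc (a + t))) n) _ _))

+-swap : ∀ a b c → a + (b + c) ≡ b + (a + c)
+-swap a b c = trans (sym (ℕ.+-assoc a b c)) (trans (cong (_+ c) (ℕ.+-comm a b)) (ℕ.+-assoc b a c))

-- The difference `m + j` is the length of window `j`.
σ-suc′ : ∀ j m → σ (suc j) m ≡ σ j m + (m + j)
σ-suc′ j m = begin
  m + j * m + (tri j + j)   ≡⟨ cong (_+ (tri j + j)) (ℕ.+-comm m (j * m)) ⟩
  j * m + m + (tri j + j)   ≡⟨ ℕ.+-assoc (j * m) m _ ⟩
  j * m + (m + (tri j + j)) ≡⟨ cong (λ x → j * m + x) (+-swap m (tri j) j) ⟩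
  j * m + (tri j + (m + j)) ≡⟨ ℕ.+-assoc (j * m) (tri j) _ ⟨
  σ j m + (m + j)           ∎
  where open ≡-Reasoning

σ-mono : ∀ {i j} m → i ≤ j → σ i m ≤ σ j m
σ-mono m i≤j = ℕ.+-mono-≤ (ℕ.*-monoˡ-≤ m i≤j) (tri-mono i≤j)
  where
  tri-mono : ∀ {i j} → i ≤ j → tri i ≤ tri j
  tri-mono z≤n     = z≤n
  tri-mono (s≤s p) = ℕ.+-mono-≤ (tri-mono p) p

σ-+ : ∀ j m Y → σ j (m + Y) ≡ σ j m + j * Y
σ-+ j m Y = begin
  j * (m + Y) + tri j       ≡⟨ cong (_+ tri j) (ℕ.*-distribˡ-+ j m Y) ⟩
  j * m + j * Y + tri j     ≡⟨ ℕ.+-assoc (j * m) (j * Y) (tri j) ⟩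
  j * m + (j * Y + tri j)   ≡⟨ cong (λ x → j * m + x) (ℕ.+-comm (j * Y) (tri j)) ⟩
  j * m + (tri j + j * Y)   ≡⟨ ℕ.+-assoc (j * m) (tri j) (j * Y) ⟨
  σ j m + j * Y             ∎
  where open ≡-Reasoning

Σ-rotate : ∀ Q a g → (∀ x → g (Q + x) ≡ g x) → Σ< Q (λ x → g (a + x)) ≡ Σ< Q g
Σ-rotate Q zero    g per = refl
Σ-rotate Q (suc a) g per =
  trans (Σ-rotate Q a (g ∘ suc) (λ x → trans (cong g (sym (ℕ.+-suc Q x))) (per (suc x))))
        (+-cancelˡ (g 0) _ _ (begin
          g 0 ⊕ Σ< Q (g ∘ suc)  ≡⟨ Σ-last Q g ⟩
          Σ< Q g ⊕ g Q          ≡⟨ cong (Σ< Q g ⊕_) (trans (cong g (sym (ℕ.+-identityʳ Q))) (per 0)) ⟩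
          Σ< Q g ⊕ g 0          ≡⟨ ℤ.+-comm (Σ< Q g) (g 0) ⟩
          g 0 ⊕ Σ< Q g          ∎))
  where open ≡-Reasoning

-- Congruence modulo N.

module Modulo (N : ℕ) .{{_ : NonZero N}} where

  infix 4 _≋_
  data _≋_ (a b : ℤ) : Set where
    mod : ∀ c → a ≡ b ⊕ c ⊗ + N → a ≋ b

  ≋-reflexive : ∀ {a b} → a ≡ b → a ≋ b
  ≋-reflexive {a} refl = mod 0ℤ (lemma a (+ N))
    where
    lemma : ∀ a n → a ≡ a ⊕ 0ℤ ⊗ n
    lemma = solve-∀

  ≋-refl : ∀ {a} → a ≋ a
  ≋-refl = ≋-reflexive refl

  ≋-sym : ∀ {a b} → a ≋ b → b ≋ a
  ≋-sym {_} {b} (mod c refl) = mod (- c) (lemma b c (+ N))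
    where
    lemma : ∀ b c n → b ≡ b ⊕ c ⊗ n ⊕ (- c) ⊗ n
    lemma = solve-∀

  ≋-trans : ∀ {a b c} → a ≋ b → b ≋ c → a ≋ c
  ≋-trans {_} {_} {c} (mod x refl) (mod y refl) = mod (x ⊕ y) (lemma c x y (+ N))
    where
    lemma : ∀ c x y n → c ⊕ y ⊗ n ⊕ x ⊗ n ≡ c ⊕ (x ⊕ y) ⊗ n
    lemma = solve-∀

  ≋-+ : ∀ {a a′ b b′} → a ≋ a′ → b ≋ b′ → a ⊕ b ≋ a′ ⊕ b′
  ≋-+ {_} {a′} {_} {b′} (mod x refl) (mod y refl) = mod (x ⊕ y) (lemma a′ b′ x y (+ N))
    where
    lemma : ∀ a b x y n → (a ⊕ x ⊗ n) ⊕ (b ⊕ y ⊗ n) ≡ a ⊕ b ⊕ (x ⊕ y) ⊗ n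
    lemma = solve-∀

  ≋-* : ∀ s {a b} → a ≋ b → s ⊗ a ≋ s ⊗ b
  ≋-* s {_} {b} (mod x refl) = mod (s ⊗ x) (lemma s b x (+ N))
    where
    lemma : ∀ s b x n → s ⊗ (b ⊕ x ⊗ n) ≡ s ⊗ b ⊕ s ⊗ x ⊗ n
    lemma = solve-∀

  ≋-*ʳ : ∀ s {a b} → a ≋ b → a ⊗ s ≋ b ⊗ s
  ≋-*ʳ s {a} {b} p = subst₂ _≋_ (ℤ.*-comm s a) (ℤ.*-comm s b) (≋-* s p)

  ≋-cancel : ∀ {a a′ b b′} → a ⊕ b ≋ a′ ⊕ b′ → b ≋ b′ → a ≋ a′
  ≋-cancel {a} {a′} {b} {b′} p q =
    subst₂ _≋_ (lemma a b) (lemma a′ b′) (≋-+ p (≋-* -1ℤ q))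
    where
    lemma : ∀ a b → a ⊕ b ⊕ -1ℤ ⊗ b ≡ a
    lemma = solve-∀

  Σ-≋ : ∀ n {g h} → (∀ x → x < n → g x ≋ h x) → Σ< n g ≋ Σ< n h
  Σ-≋ zero    e = ≋-refl
  Σ-≋ (suc n) e = ≋-+ (e 0 (s≤s z≤n)) (Σ-≋ n (λ x p → e (suc x) (s≤s p)))

  anti-≋ : ∀ n {F F′} → (∀ i l → F i l ≋ F′ i l) → anti F n ≋ anti F′ n
  anti-≋ n e = Σ-≋ (suc n) (λ i _ → e i (n ∸ i))

  %⇒≋ : ∀ x y → x % N ≡ y % N → + x ≋ + y
  %⇒≋ x y eq = ≋-trans (≋-% x) (≋-trans (≋-reflexive (cong +_ eq)) (≋-sym (≋-% y)))
    where
    ≋-% : ∀ x → + x ≋ + (x % N)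
    ≋-% x = mod (+ x /ℕ N) (a≡a%ℕn+[a/ℕn]*n (+ x) N)

  residue-unique : ∀ {r s} → r < N → s < N → + r ≋ + s → r ≡ s
  residue-unique {r} {s} r<N s<N (mod (+ c) eq) = nonneg r<N s<N c eq
    where
    nonneg : ∀ {r s} → r < N → s < N → ∀ c → + r ≡ + s ⊕ + c ⊗ + N → r ≡ s
    nonneg {r} {s} r<N s<N c eq = begin
      r               ≡⟨ m<n⇒m%n≡m r<N ⟨
      r % N           ≡⟨ cong (_% N) (ℤ.+-injective (trans eq (trans (cong (+ s ⊕_) (sym (ℤ.pos-* c N))) (sym (ℤ.pos-+ s (c * N)))))) ⟩
      (s + c * N) % N ≡⟨ [m+kn]%n≡m%n s c N ⟩
      s % N           ≡⟨ m<n⇒m%n≡m s<N ⟩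
      s               ∎
      where open ≡-Reasoning
  -- A negative quotient becomes positive when `r` and `s` change places.
  residue-unique {r} {s} r<N s<N (mod -[1+ c ] eq) =
    sym (residue-unique s<N r<N (mod (+ suc c) (trans (lemma (+ s) (-[1+ c ]) (+ N)) (cong (_⊕ + suc c ⊗ + N) (sym eq)))))
    where
    lemma : ∀ s c n → s ≡ s ⊕ c ⊗ n ⊕ (- c) ⊗ n
    lemma = solve-∀

  ≋⇒%ℕ : ∀ {a b} → a ≋ b → a %ℕ N ≡ b %ℕ N
  ≋⇒%ℕ {a} {b} p = residue-unique (n%ℕd<d a N) (n%ℕd<d b N)
    (≋-trans (≋-sym (≋-%ℕ a)) (≋-trans p (≋-%ℕ b)))
    where
    ≋-%ℕ : ∀ a → a ≋ + (a %ℕ N)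
    ≋-%ℕ a = mod (a /ℕ N) (a≡a%ℕn+[a/ℕn]*n a N)

  ≋⇒% : ∀ {x y} → + x ≋ + y → x % N ≡ y % N
  ≋⇒% = ≋⇒%ℕ

  -- Periods modulo N.

  Per : ℕ → (ℕ → ℤ) → Set
  Per X g = ∀ n → g (X + n) ≋ g n

  Per-* : ∀ c {X g} → Per X g → Per (c * X) g
  Per-* zero            per n = ≋-refl
  Per-* (suc c) {X} {g} per n =
    ≋-trans (≋-reflexive (cong g (ℕ.+-assoc X (c * X) n))) (≋-trans (per (c * X + n)) (Per-* c per n))

  Per-∣ : ∀ {X Y g} → X ℕ.∣ Y → Per X g → Per Y g
  Per-∣ {g = g} (ℕ.divides c refl) per = Per-* c {g = g} per

  Per-≡ : ∀ {X g h} → (∀ n → g n ≡ h n) → Per X g → Per X h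
  Per-≡ {X} e per n = subst₂ _≋_ (e (X + n)) (e n) (per n)

  minPeriod⇒Per : ∀ {j π} → IsMinPeriod N j π → Per π (P j)
  minPeriod⇒Per {j} {π} (_ , per , _) n =
    %⇒≋ (p≤ j (π + n)) (p≤ j n) (trans (cong (λ x → p≤ j x % N) (ℕ.+-comm π n)) (per n))

  -- The remainder `q % π` is again a period and lies below the minimal one, so it is 0.
  minPeriod-∣ : ∀ {j π q} → IsMinPeriod N j π → Per q (P j) → π ℕ.∣ q
  minPeriod-∣ {j} {suc π₀} {q} isMin@(_ , _ , minimal) per = ℕ.m%n≡0⇒n∣m q π (remainder≡0 (q % π) refl)
    where
    π = suc π₀
    per-r : Per (q % π) (P j)
    per-r n = ≋-trans (≋-sym (Per-* (q / π) {g = P j} (minPeriod⇒Per {j} isMin) (q % π + n)))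
      (≋-trans (≋-reflexive (cong (P j) (begin
        q / π * π + (q % π + n) ≡⟨ ℕ.+-assoc (q / π * π) (q % π) n ⟨
        q / π * π + q % π + n   ≡⟨ cong (_+ n) (ℕ.+-comm (q / π * π) (q % π)) ⟩
        q % π + q / π * π + n   ≡⟨ cong (_+ n) (m≡m%n+[m/n]*n q π) ⟨
        q + n                   ∎))) (per n))
      where open ≡-Reasoning
    remainder≡0 : ∀ r → q % π ≡ r → q % π ≡ 0
    remainder≡0 zero    eq = eq
    remainder≡0 (suc r) eq = ⊥-elim (minimal (q % π) (subst (1 ≤_) (sym eq) (s≤s z≤n)) (m%n<n q π)
      (λ n → ≋⇒% (≋-trans (≋-reflexive (cong (P j) (ℕ.+-comm n (q % π)))) (per-r n))))

  -- P j = (1 − q^{j+1}) P (j+1) is X-periodic from j + 1 on; pure periodicity with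
  -- period Y extends this to all indices.
  Per-pred : ∀ j {X Y} → 1 ≤ Y → Per Y (P j) → Per X (P (suc j)) → Per X (P j)
  Per-pred j {X} {Y} 1≤Y perY perX n =
    ≋-trans (≋-sym (Per-* c {g = P j} perY (X + n)))
   (≋-trans (≋-reflexive (cong (P j) (+-swap (c * Y) X n)))
   (≋-trans (late (c * Y + n) (ℕ.≤-trans (ℕ.m≤m*n c Y {{>-nonZero 1≤Y}}) (ℕ.m≤m+n (c * Y) n)))
            (Per-* c {g = P j} perY n)))
    where
    c = suc j
    rec : ∀ y → P c (c + y) ≡ P j (c + y) ⊕ P c y
    rec y = trans (P-rec j (c + y)) (cong (P j (c + y) ⊕_) (sh-≥ c (P c) y))
    late : ∀ x → c ≤ x → P j (X + x) ≋ P j x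
    late x c≤x with ℕ.m≤n⇒∃[o]m+o≡n c≤x
    ... | y , refl = ≋-trans (≋-reflexive (cong (P j) (+-swap X c y)))
      (≋-cancel (≋-trans (≋-reflexive (sym (rec (X + y))))
                (≋-trans (≋-reflexive (cong (P c) (+-swap c X y)))
                (≋-trans (perX (c + y)) (≋-reflexive (rec y)))))
                (perX y))

  -- The second argument of `F` runs over a range fixed by `a`; `n` enters only through the first.
  tail-per : ∀ a {X} F → (∀ s t → F (X + s) t ≋ F s t) → Per X (tail F a)
  tail-per zero        F per n = ≋-refl
  tail-per (suc a) {X} F per n =
    ≋-+ (tail-per a (λ s t → F s (suc t)) (λ s t → per s (suc t)) n)
        (≋-trans (≋-reflexive (cong (λ s → F s 0) (trans (cong suc (+-swap a X n)) (sym (ℕ.+-suc X (a + n))))))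
                 (per (suc (a + n)) 0))

  -- B i l (X + n) − B i l n is X-periodic, so N such steps cancel modulo N.
  Per-B : ∀ i l {X} → Per X (P i) → Per X (P l) → Per (N * X) (B i l)
  Per-B i l {X} perᵢ perₗ n = ≋-trans (steps N n) (mod (e n) (cong (B i l n ⊕_) (ℤ.*-comm (+ N) (e n))))
    where
    F : ℕ → ℕ → ℤ
    F s t = P i s ⊗ P l t
    e : ℕ → ℤ
    e = tail F X
    e-per : Per X e
    e-per = tail-per X F (λ s t → ≋-*ʳ (P l t) (perᵢ s))
    -- The pairs with t ≥ X reproduce `B i l n` by periodicity of `P l`; those with t < X make up
    -- `e n`.
    step : ∀ n → B i l (X + n) ≋ B i l n ⊕ e n
    step n = ≋-trans (≋-reflexive (anti-split X F n))
                     (≋-+ (anti-≋ n (λ s t → ≋-* (P i s) (perₗ t))) ≋-refl)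
    regroup : ∀ b c e → b ⊕ c ⊗ e ⊕ e ≡ b ⊕ (1ℤ ⊕ c) ⊗ e
    regroup = solve-∀
    steps : ∀ c n → B i l (c * X + n) ≋ B i l n ⊕ + c ⊗ e n
    steps zero    n = ≋-reflexive (sym (trans (cong (B i l n ⊕_) (ℤ.*-zeroˡ (e n))) (ℤ.+-identityʳ (B i l n))))
    steps (suc c) n =
      ≋-trans (≋-reflexive (cong (B i l) (ℕ.+-assoc X (c * X) n)))
     (≋-trans (step (c * X + n))
     (≋-trans (≋-+ (steps c n) (Per-* c {g = e} e-per n))
              (≋-reflexive (regroup (B i l n) (+ c) (e n)))))

  -- The longer partial sum splits off one full period, which sums to 0; what remains is the shorter
  -- partial sum, shifted by a period.
  Per-B-1 : ∀ l {X} → Per X (P l) → Σ< X (P l) ≋ 0ℤ → Per X (B 1 l)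
  Per-B-1 l {X} per sum≋0 n =
    ≋-trans (≋-reflexive (trans (B-1 l (X + n)) (trans (cong (λ x → Σ< x (P l)) (sym (ℕ.+-suc X n))) (Σ-split X (suc n) (P l)))))
   (≋-trans (≋-+ sum≋0 (Σ-≋ (suc n) (λ x _ → per x)))
            (≋-reflexive (trans (ℤ.+-identityˡ _) (sym (B-1 l n)))))

  sh-per : ∀ {X} c g α → Per X g → c ≤ α → sh c g (X + α) ≋ sh c g α
  sh-per {X} c g α per c≤α with ℕ.m≤n⇒∃[o]m+o≡n c≤α
  ... | y , refl = subst₂ _≋_
    (trans (sym (sh-≥ c g (X + y))) (cong (sh c g) (+-swap c X y)))
    (sym (sh-≥ c g y)) (per y)

  -- Raising the exponent by `X` reads `g` one period earlier. The bound on `α` keeps both sides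
  -- clear of the default value 0.
  sh-per-exponent : ∀ {X} c g α → Per X g → c + X ≤ α → sh (c + X) g α ≋ sh c g α
  sh-per-exponent {X} c g α per c+X≤α with ℕ.m≤n⇒∃[o]m+o≡n c+X≤α
  ... | y , refl = subst₂ _≋_
    (sym (sh-≥ (c + X) g y))
    (trans (sym (sh-≥ c g (X + y))) (cong (sh c g) (sym (ℕ.+-assoc c X y))))
    (≋-sym (per y))

  -- Counting by windows.

  -- For α < σ (j+1) m the coefficient of q^α only involves the terms i ≤ j; their
  -- sum U j m is periodic from σ j m on, and Σ< Q over one period gives the
  -- number of new indices in the window [σ j m , σ (j+1) m) when m grows by Q.
  module Windows
    (k Q M : ℕ) (M∣Q : M ℕ.∣ Q)
    (per-P : Per Q (P k))
    (per-B : ∀ i l → 1 ≤ i → 1 ≤ l → i + l ≡ k → Per M (B i l))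
    (ρ : ℤ → ℤ) (ρ-cong : ∀ {a b} → a ≋ b → ρ a ≡ ρ b)
    where

    U : ℕ → ℕ → ℕ → ℤ
    U j m α = Σ< (suc j) (λ i → term i (k ∸ i) m α)

    -- Index 0 is left out: `B 0 k` is only known to have the period `Q`, but its exponent `σ 0 m`
    -- is 0 for every `m`, so that summand does not change with `m`.
    Shift : ℕ → Set
    Shift Y = ∀ i → 1 ≤ i → i < k → Per Y (B i (k ∸ i))

    shift-M : Shift M
    shift-M i 1≤i i<k = per-B i (k ∸ i) 1≤i (ℕ.m<n⇒0<n∸m i<k) (ℕ.m+[n∸m]≡n (ℕ.<⇒≤ i<k))

    shift-Q : Shift Q
    shift-Q i 1≤i i<k = Per-∣ {g = B i (k ∸ i)} M∣Q (shift-M i 1≤i i<k)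

    per-term : ∀ i → i < k → Per Q (B i (k ∸ i))
    per-term zero    _   = Per-≡ (λ n → sym (B-0 k n)) per-P
    per-term (suc i) i<k = shift-Q (suc i) (s≤s z≤n) i<k

    U-per : ∀ {j} m α → j < k → σ j m ≤ α → U j m (Q + α) ≋ U j m α
    U-per {j} m α j<k σ≤α = Σ-≋ (suc j) (λ { i (s≤s i≤j) →
      ≋-* (-1ℤ ^ i) (sh-per (σ i m) (B i (k ∸ i)) α (per-term i (ℕ.≤-<-trans i≤j j<k))
                            (ℕ.≤-trans (σ-mono m i≤j) σ≤α)) })

    -- The exponent of the summand `i` grows by `i * Y`, a multiple of its period.
    U-shift : ∀ {Y} → Shift Y → ∀ {j} m α → j < k → σ j m + j * Y ≤ α → U j (m + Y) α ≋ U j m α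
    U-shift {Y} shift {j} m α j<k σ≤α = Σ-≋ (suc j) (λ { i (s≤s i≤j) → ≋-* (-1ℤ ^ i) (one i i≤j) })
      where
      one : ∀ i → i ≤ j → sh (σ i (m + Y)) (B i (k ∸ i)) α ≋ sh (σ i m) (B i (k ∸ i)) α
      one zero      _   = ≋-refl
      one i@(suc _) i≤j =
        ≋-trans (≋-reflexive (cong (λ c → sh c (B i (k ∸ i)) α) (σ-+ i m Y)))
                (sh-per-exponent (σ i m) (B i (k ∸ i)) α
                  (Per-* i {g = B i (k ∸ i)} (shift i (s≤s z≤n) (ℕ.≤-<-trans i≤j j<k)))
                  (ℕ.≤-trans (ℕ.+-mono-≤ (σ-mono m i≤j) (ℕ.*-monoˡ-≤ Y i≤j)) σ≤α))

    v : ℕ → ℕ → ℕ → ℤ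
    v j m x = ρ (U j m (σ j m + x))

    v-per : ∀ {j} m x → j < k → v j m (Q + x) ≡ v j m x
    v-per {j} m x j<k = trans (cong (λ α → ρ (U j m α)) (+-swap (σ j m) Q x))
      (ρ-cong (U-per m (σ j m + x) j<k (ℕ.m≤m+n (σ j m) x)))

    -- The values of `U j` do not change modulo N, but the start of the window moves by `j * Y`.
    v-shift : ∀ {Y} → Shift Y → ∀ {j} m x → j < k → v j (m + Y) x ≡ v j m (j * Y + x)
    v-shift {Y} shift {j} m x j<k = begin
      ρ (U j (m + Y) (σ j (m + Y) + x))     ≡⟨ cong (λ α → ρ (U j (m + Y) (α + x))) (σ-+ j m Y) ⟩
      ρ (U j (m + Y) (σ j m + j * Y + x))   ≡⟨ ρ-cong (U-shift shift m _ j<k (ℕ.m≤m+n (σ j m + j * Y) x)) ⟩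
      ρ (U j m (σ j m + j * Y + x))         ≡⟨ cong (λ α → ρ (U j m α)) (ℕ.+-assoc (σ j m) (j * Y) x) ⟩
      v j m (j * Y + x)                     ∎
      where open ≡-Reasoning

    window : ℕ → ℕ → ℤ
    window j m = Σ< (m + j) (v j m)

    slope : ℕ → ℕ → ℤ
    slope j m = Σ< Q (v j m)

    -- The values are rotated by `j * M`, and a sum over the full period `Q` is invariant under
    -- rotation.
    slope-M : ∀ {j} m → j < k → slope j (m + M) ≡ slope j m
    slope-M {j} m j<k = trans (Σ-cong Q (λ x _ → v-shift shift-M m x j<k))
                              (Σ-rotate Q (j * M) (v j m) (λ x → v-per m x j<k))

    v-Q : ∀ {j} m x → j < k → v j (m + Q) x ≡ v j m x
    v-Q {j} m x j<k = trans (v-shift shift-Q m x j<k) (multiple j)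
      where
      multiple : ∀ c → v j m (c * Q + x) ≡ v j m x
      multiple zero    = refl
      multiple (suc c) = trans (cong (v j m) (ℕ.+-assoc Q (c * Q) x))
                        (trans (v-per m (c * Q + x) j<k) (multiple c))

    window-Q : ∀ {j} m → j < k → window j (m + Q) ≡ window j m ⊕ slope j m
    window-Q {j} m j<k = begin
      Σ< (m + Q + j) (v j (m + Q))
        ≡⟨ Σ-cong (m + Q + j) (λ x _ → v-Q m x j<k) ⟩
      Σ< (m + Q + j) (v j m)
        ≡⟨ cong (λ n → Σ< n (v j m)) (trans (ℕ.+-assoc m Q j) (trans (cong (λ x → m + x) (ℕ.+-comm Q j)) (sym (ℕ.+-assoc m j Q)))) ⟩
      Σ< (m + j + Q) (v j m)
        ≡⟨ Σ-split (m + j) Q (v j m) ⟩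
      window j m ⊕ Σ< Q (λ x → v j m (m + j + x))
        ≡⟨ cong (window j m ⊕_) (Σ-rotate Q (m + j) (v j m) (λ x → v-per m x j<k)) ⟩
      window j m ⊕ slope j m
        ∎
      where open ≡-Reasoning

    count : ℕ → ℕ → ℤ
    count j m = Σ< (σ j m) (λ α → ρ (U j m α))

    count-suc : ∀ j m → count (suc j) m ≡ count j m ⊕ window j m
    count-suc j m = begin
      Σ< (σ (suc j) m) (λ α → ρ (U (suc j) m α))
        ≡⟨ Σ-cong (σ (suc j) m) (λ α α<σ → cong ρ (drop-last α α<σ)) ⟩
      Σ< (σ (suc j) m) (λ α → ρ (U j m α))
        ≡⟨ cong (λ n → Σ< n (λ α → ρ (U j m α))) (σ-suc′ j m) ⟩
      Σ< (σ j m + (m + j)) (λ α → ρ (U j m α))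
        ≡⟨ Σ-split (σ j m) (m + j) (λ α → ρ (U j m α)) ⟩
      count j m ⊕ window j m
        ∎
      where
      open ≡-Reasoning
      drop-last : ∀ α → α < σ (suc j) m → U (suc j) m α ≡ U j m α
      drop-last α α<σ = begin
        U (suc j) m α
          ≡⟨ Σ-last (suc j) (λ i → term i (k ∸ i) m α) ⟩
        U j m α ⊕ (-1ℤ ^ suc j) ⊗ sh (σ (suc j) m) (B (suc j) (k ∸ suc j)) α
          ≡⟨ cong (λ z → U j m α ⊕ (-1ℤ ^ suc j) ⊗ z) (sh-< (σ (suc j) m) _ α α<σ) ⟩
        U j m α ⊕ (-1ℤ ^ suc j) ⊗ 0ℤ
          ≡⟨ trans (cong (U j m α ⊕_) (ℤ.*-zeroʳ (-1ℤ ^ suc j))) (ℤ.+-identityʳ (U j m α)) ⟩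
        U j m α
          ∎

    totalSlope : ℕ → ℕ → ℤ
    totalSlope zero    m = 0ℤ
    totalSlope (suc j) m = totalSlope j m ⊕ slope j m

    count-Q : ∀ j m → j ≤ k → count j (m + Q) ≡ count j m ⊕ totalSlope j m
    count-Q zero    m _   = refl
    count-Q (suc j) m j<k = begin
      count (suc j) (m + Q)
        ≡⟨ count-suc j (m + Q) ⟩
      count j (m + Q) ⊕ window j (m + Q)
        ≡⟨ cong₂ _⊕_ (count-Q j m (ℕ.<⇒≤ j<k)) (window-Q m j<k) ⟩
      (count j m ⊕ totalSlope j m) ⊕ (window j m ⊕ slope j m)
        ≡⟨ interchange (count j m) (totalSlope j m) (window j m) (slope j m) ⟩
      (count j m ⊕ window j m) ⊕ totalSlope (suc j) m
        ≡⟨ cong (_⊕ totalSlope (suc j) m) (count-suc j m) ⟨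
      count (suc j) m ⊕ totalSlope (suc j) m
        ∎
      where open ≡-Reasoning

    totalSlope-M : ∀ j m → j ≤ k → totalSlope j (m + M) ≡ totalSlope j m
    totalSlope-M zero    m _   = refl
    totalSlope-M (suc j) m j<k = cong₂ _⊕_ (totalSlope-M j m (ℕ.<⇒≤ j<k)) (slope-M m j<k)

    totalSlope-*M : ∀ c m → totalSlope k (m + c * M) ≡ totalSlope k m
    totalSlope-*M zero    m = cong (totalSlope k) (ℕ.+-identityʳ m)
    totalSlope-*M (suc c) m =
      trans (cong (totalSlope k) (sym (ℕ.+-assoc m M (c * M))))
     (trans (totalSlope-*M c (m + M)) (totalSlope-M k m ℕ.≤-refl))

-- Counting by indicators, factors of π′, and residue classes.

+-length-filter : ∀ {p} {Pr : ℕ → Set p} (Pr? : Decidable Pr) φ n →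
  + length (filter Pr? (applyUpTo φ n)) ≡ Σ< n (λ x → if does (Pr? (φ x)) then 1ℤ else 0ℤ)
+-length-filter Pr? φ zero = refl
+-length-filter Pr? φ (suc n) with does (Pr? (φ 0))
... | true  = trans (ℤ.pos-+ 1 _) (cong (1ℤ ⊕_) (+-length-filter Pr? (φ ∘ suc) n))
... | false = trans (+-length-filter Pr? (φ ∘ suc) n) (sym (ℤ.+-identityˡ _))

-- The factor is r when N divides r and N r otherwise; either way both N and r divide it.
π′-factor : ∀ N π j → ∃[ d ] (π′ N π (suc (suc j)) ≡ d * π′ N π (suc j)) × (N ℕ.∣ d) × (π (suc (suc j)) div π (suc j) ℕ.∣ d)
π′-factor N π j with N ℕ.∣? π (suc (suc j)) div π (suc j)
... | yes N∣r = _ , refl , N∣r , ℕ.∣-refl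
... | no  _   = _ , refl , ℕ.m∣m*n _ , ℕ.n∣m*n N

div-* : ∀ {a b} → 1 ≤ b → b ℕ.∣ a → (a div b) * b ≡ a
div-* {b = suc b} _ (ℕ.divides q refl) = cong (_* suc b) (m*n/n≡m q (suc b))

∣+m-+n∣ : ∀ m n → (m ≤ n × n ≡ m + ∣ + n - + m ∣) ⊎ (n ≤ m × m ≡ n + ∣ + n - + m ∣)
∣+m-+n∣ m n with ℕ.≤-total m n
... | inj₁ m≤n = inj₁ (m≤n , trans (sym (ℕ.m+[n∸m]≡n m≤n))
  (cong (λ x → m + x) (sym (cong ∣_∣ (trans (ℤ.m-n≡m⊖n n m) (ℤ.⊖-≥ m≤n))))))
... | inj₂ n≤m = inj₂ (n≤m , trans (sym (ℕ.m+[n∸m]≡n n≤m))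
  (cong (λ x → n + x) (sym (trans (cong ∣_∣ (ℤ.m-n≡m⊖n n m)) (trans (ℤ.∣m⊖n∣≡∣n⊖m∣ n m) (cong ∣_∣ (ℤ.⊖-≥ n≤m)))))))

-- Integer divisibility concerns absolute values, so the two signs of the difference are treated
-- separately.
congruent : ∀ {n n′ M Q} → M ℕ.∣ Q → (+ Q) ∣ (+ n′ - + (n + M)) →
  (∃[ c ] n′ ≡ n + c * M) ⊎ (∃[ c ] n ≡ n′ + c * M)
congruent {n} {n′} {M} M∣Q Q∣z with ℕ.∣-trans M∣Q Q∣z | ∣+m-+n∣ (n + M) n′
... | ℕ.divides q eq | inj₁ (_ , n′≡) = inj₁ (suc q , trans n′≡ (trans (cong (λ x → n + M + x) eq) (ℕ.+-assoc n M (q * M))))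
... | ℕ.divides zero eq | inj₂ (_ , n+M≡) =
  inj₁ (1 , trans (sym (trans n+M≡ (trans (cong (λ x → n′ + x) eq) (ℕ.+-identityʳ n′)))) (cong (λ x → n + x) (sym (ℕ.*-identityˡ M))))
-- Here n + M = n′ + (q + 1) M, and one `M` cancels.
... | ℕ.divides (suc q) eq | inj₂ (_ , n+M≡) =
  inj₂ (q , ℕ.+-cancelʳ-≡ M n (n′ + q * M) (trans n+M≡ (trans (cong (λ x → n′ + x) (trans eq (ℕ.+-comm M (q * M)))) (sym (ℕ.+-assoc n′ (q * M) M)))))

theorem5p2 : (N : ℕ) → .{{_ : NonZero N}} → N % 2 ≡ 1 →
    (k : ℕ) → 2 ≤ k →
    (π : ℕ → ℕ) → (∀ j → 1 ≤ j → j ≤ k → IsMinPeriod N j (π j)) →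
    sum (map (p≤ (k ∸ 1)) (upTo (π (k ∸ 1)))) % N ≡ 0 →
    (R : Fin N) → (n n′ : ℕ) → k ≤ n → k ≤ n′ →
    (+ (π′ N π k)) ∣ ((+ n′) - (+ (n + π′ N π (k ∸ 1)))) →
    (+ f N k R (n + π′ N π k)) - (+ f N k R n)
    ≡ (+ f N k R (n′ + π′ N π k)) - (+ f N k R n′)
theorem5p2 N _ zero ()
theorem5p2 N _ (suc zero) (s≤s ())
theorem5p2 N _ k@(suc (suc κ)) _ π minPer sum%N≡0 R n n′ k≤n k≤n′ Q∣z =
  -- The increment over `Q` is the total slope at m = n - k + 1, which does not change when `n`
  -- moves by a multiple of `M`.
  trans (increment n k≤n) (trans (same-slope (congruent M∣Q Q∣z)) (sym (increment n′ k≤n′)))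
  where
  open Modulo N
  open ≡-Reasoning
  Q M : ℕ
  Q = π′ N π k
  M = π′ N π (suc κ)

  per-π : ∀ j → 1 ≤ j → j ≤ k → Per (π j) (P j)
  per-π j 1≤j j≤k = minPeriod⇒Per {j} (minPer j 1≤j j≤k)

  -- By `Per-pred` the period of the longer product is also one of the shorter, hence a multiple of
  -- its minimal period.
  π-∣-suc : ∀ j → suc (suc j) ≤ k → π (suc j) ℕ.∣ π (suc (suc j))
  π-∣-suc j j<k = minPeriod-∣ {suc j} min-j
    (Per-pred (suc j) {X = π (suc (suc j))} (proj₁ min-j) (minPeriod⇒Per {suc j} min-j) (per-π (suc (suc j)) (s≤s z≤n) j<k))
    where
    min-j = minPer (suc j) (s≤s z≤n) (ℕ.<⇒≤ j<k)

  π-∣ : ∀ i d → suc (d + i) ≤ k → π (suc i) ℕ.∣ π (suc (d + i))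
  π-∣ i zero    _   = ℕ.∣-refl
  π-∣ i (suc d) d<k = ℕ.∣-trans (π-∣ i d (ℕ.<⇒≤ d<k)) (π-∣-suc (d + i) d<k)

  π∣π′ : ∀ j → suc j ≤ k → π (suc j) ℕ.∣ π′ N π (suc j)
  -- `P 1` is constant, so 1 is a period.
  π∣π′ zero    1≤k = minPeriod-∣ {1} (minPer 1 (s≤s z≤n) 1≤k) (λ x → ≋-reflexive (trans (P-1 (suc x)) (sym (P-1 x))))
  π∣π′ (suc j) j<k with π′-factor N π j
  ... | d , eq , _ , r∣d = subst₂ ℕ._∣_
    (div-* (proj₁ (minPer (suc j) (s≤s z≤n) (ℕ.<⇒≤ j<k))) (π-∣-suc j j<k)) (sym eq)
    (ℕ.*-pres-∣ r∣d (π∣π′ j (ℕ.<⇒≤ j<k)))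

  -- Provides the factor `N` that `Per-B` puts in front of a common period.
  N*π∣π′ : ∀ j → suc (suc j) ≤ k → N * π (suc j) ℕ.∣ π′ N π (suc (suc j))
  N*π∣π′ j j<k with π′-factor N π j
  ... | d , eq , N∣d , _ = subst (N * π (suc j) ℕ.∣_) (sym eq) (ℕ.*-pres-∣ N∣d (π∣π′ j (ℕ.<⇒≤ j<k)))

  M∣Q : M ℕ.∣ Q
  M∣Q with π′-factor N π κ
  ... | d , eq , _ = ℕ.divides d eq

  per-P : Per Q (P k)
  per-P = Per-∣ {g = P k} (π∣π′ (suc κ) ℕ.≤-refl) (per-π k (s≤s z≤n) ℕ.≤-refl)

  sum≋0 : Σ< (π (suc κ)) (P (suc κ)) ≋ 0ℤ
  sum≋0 = ≋-trans (≋-reflexive (sym (+-sum-applyUpTo (p≤ (suc κ)) id (π (suc κ)))))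
    (%⇒≋ _ 0 (trans sum%N≡0 (sym (m*n%n≡0 0 N))))

  per-B-1 : Per M (B 1 (suc κ))
  per-B-1 = Per-∣ {g = B 1 (suc κ)} (π∣π′ κ (ℕ.n≤1+n _))
    (Per-B-1 (suc κ) {π (suc κ)} (per-π (suc κ) (s≤s z≤n) (ℕ.n≤1+n _)) sum≋0)

  per-below : ∀ κ′ → suc κ′ ≤ k → ∀ i → 1 ≤ i → i ≤ suc κ′ → Per (π (suc κ′)) (P i)
  per-below κ′ κ′<k (suc i) _ (s≤s i≤κ′) = Per-∣ {g = P (suc i)}
    (subst (λ x → π (suc i) ℕ.∣ π (suc x)) (ℕ.m∸n+n≡m i≤κ′)
      (π-∣ i (κ′ ∸ i) (subst (λ x → suc x ≤ k) (sym (ℕ.m∸n+n≡m i≤κ′)) κ′<k)))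
    (per-π (suc i) (s≤s z≤n) (ℕ.≤-trans (s≤s i≤κ′) κ′<k))

  per-B : ∀ i l → 1 ≤ i → 1 ≤ l → i + l ≡ k → Per M (B i l)
  per-B (suc zero)    l             _ _ refl = per-B-1
  per-B (suc (suc a)) (suc zero)    _ _ eq   = subst (λ i → Per M (B i 1))
    (sym (ℕ.+-cancelʳ-≡ 1 (suc (suc a)) (suc κ) (trans eq (ℕ.+-comm 1 (suc κ)))))
    (Per-≡ {M} (B-comm 1 (suc κ)) per-B-1)
  per-B (suc (suc a)) (suc (suc b)) _ _ eq = interior κ refl
    where
    i+l : a + suc (suc b) ≡ κ
    i+l = ℕ.suc-injective (ℕ.suc-injective eq)
    i≤ : suc (suc a) ≤ κ
    i≤ = subst (suc (suc a) ≤_) i+l (subst (_≤ a + suc (suc b)) (ℕ.+-comm a 2) (ℕ.+-monoʳ-≤ a (s≤s (s≤s z≤n))))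
    l≤ : suc (suc b) ≤ κ
    l≤ = subst (suc (suc b) ≤_) i+l (ℕ.m≤n+m _ a)
    -- Both indices are at most κ = k - 2, which is therefore positive; splitting `x` exhibits it as
    -- a successor, and π (k - 2) is a common period.
    interior : ∀ x → x ≡ κ → Per (π′ N π (suc κ)) (B (suc (suc a)) (suc (suc b)))
    interior zero      refl with () ← i≤
    interior (suc κ′) refl = Per-∣ {g = B (suc (suc a)) (suc (suc b))} (N*π∣π′ κ′ (ℕ.n≤1+n _))
      (Per-B (suc (suc a)) (suc (suc b)) (per-below κ′ (ℕ.m≤n+m _ 2) _ (s≤s z≤n) i≤)
                                         (per-below κ′ (ℕ.m≤n+m _ 2) _ (s≤s z≤n) l≤))

  -- The residue is taken in ℤ because the truncated alternating sums `U` are integers; on a natural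
  -- number it is the test made in `f`.
  ρ : ℤ → ℤ
  ρ z = if does (z %ℕ N ℕ.≟ toℕ R) then 1ℤ else 0ℤ

  open Windows k Q M M∣Q per-P per-B ρ (λ a≋b → cong (λ r → if does (r ℕ.≟ toℕ R) then 1ℤ else 0ℤ) (≋⇒%ℕ a≋b))

  -- The indices beyond the degree k m that lie below σ k (m + 1).
  surplus : ℤ
  surplus = Σ< (suc κ + tri k) (λ _ → ρ 0ℤ)

  count-f : ∀ m → count k (suc m) ≡ + f N k R (m + k) ⊕ surplus
  count-f m = begin
    Σ< (σ k (suc m)) (λ α → ρ (H k (suc m) α))
      ≡⟨ Σ-cong (σ k (suc m)) (λ α _ → cong ρ (sym (G-H k m α))) ⟩
    Σ< (σ k (suc m)) g
      ≡⟨ cong (λ x → Σ< x g) length≡ ⟩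
    Σ< (suc (k * m) + (suc κ + tri k)) g
      ≡⟨ Σ-split (suc (k * m)) (suc κ + tri k) g ⟩
    Σ< (suc (k * m)) g ⊕ Σ< (suc κ + tri k) (λ x → g (suc (k * m) + x))
      ≡⟨ cong₂ _⊕_ f≡ (Σ-cong (suc κ + tri k) (λ x _ → cong ρ (G-degree k m (suc (k * m) + x) (ℕ.m≤m+n _ x)))) ⟩
    + f N k R (m + k) ⊕ surplus
      ∎
    where
    g : ℕ → ℤ
    g α = ρ (G (m + k) k α)
    length≡ : σ k (suc m) ≡ suc (k * m) + (suc κ + tri k)
    length≡ = begin
      k * suc m + tri k                  ≡⟨ cong (_+ tri k) (ℕ.*-suc k m) ⟩
      suc (suc κ + k * m) + tri k        ≡⟨ cong (λ x → suc x + tri k) (ℕ.+-comm (suc κ) (k * m)) ⟩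
      suc (k * m + suc κ) + tri k        ≡⟨ ℕ.+-assoc (suc (k * m)) (suc κ) (tri k) ⟩
      suc (k * m) + (suc κ + tri k)      ∎
    f≡ : Σ< (suc (k * m)) g ≡ + f N k R (m + k)
    f≡ = begin
      Σ< (suc (k * m)) g
        ≡⟨ cong (λ x → Σ< (suc (k * x)) g) (ℕ.m+n∸n≡m m k) ⟨
      Σ< (suc (k * (m + k ∸ k))) g
        ≡⟨ +-length-filter (λ α → gauss (m + k) k α % N ℕ.≟ toℕ R) id (suc (k * (m + k ∸ k))) ⟨
      + f N k R (m + k)
        ∎

  increment′ : ∀ m → + f N k R (m + k + Q) - + f N k R (m + k) ≡ totalSlope k (suc m)
  increment′ m = begin
    + f N k R (m + k + Q) - F
      ≡⟨ cong (λ x → + f N k R x - F) (trans (ℕ.+-assoc m k Q) (trans (cong (λ x → m + x) (ℕ.+-comm k Q)) (sym (ℕ.+-assoc m Q k)))) ⟩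
    + f N k R (m + Q + k) - F
      -- `surplus` does not depend on `m`, so it cancels from the difference.
      ≡⟨ cong (_- F) (+-cancelʳ surplus (+ f N k R (m + Q + k)) (F ⊕ t) (begin
           + f N k R (m + Q + k) ⊕ surplus    ≡⟨ count-f (m + Q) ⟨
           count k (suc m + Q)                ≡⟨ count-Q k (suc m) ℕ.≤-refl ⟩
           count k (suc m) ⊕ t                ≡⟨ cong (_⊕ t) (count-f m) ⟩
           F ⊕ surplus ⊕ t                    ≡⟨ move F surplus t ⟩
           F ⊕ t ⊕ surplus                    ∎)) ⟩
    F ⊕ t - F
      ≡⟨ cancel F t ⟩
    t
      ∎
    where
    F = + f N k R (m + k)
    t = totalSlope k (suc m)
    move : ∀ a b c → a ⊕ b ⊕ c ≡ a ⊕ c ⊕ b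
    move = solve-∀
    cancel : ∀ a b → a ⊕ b - a ≡ b
    cancel = solve-∀

  increment : ∀ n → k ≤ n → + f N k R (n + Q) - + f N k R n ≡ totalSlope k (suc (n ∸ k))
  increment n k≤n = subst (λ x → + f N k R (x + Q) - + f N k R x ≡ totalSlope k (suc (n ∸ k)))
    (ℕ.m∸n+n≡m k≤n) (increment′ (n ∸ k))

  slope-+ : ∀ n c → k ≤ n → totalSlope k (suc (n + c * M ∸ k)) ≡ totalSlope k (suc (n ∸ k))
  slope-+ n c k≤n = trans (cong (totalSlope k ∘ suc) (ℕ.+-∸-comm (c * M) k≤n)) (totalSlope-*M c (suc (n ∸ k)))

  same-slope : (∃[ c ] n′ ≡ n + c * M) ⊎ (∃[ c ] n ≡ n′ + c * M) →
    totalSlope k (suc (n ∸ k)) ≡ totalSlope k (suc (n′ ∸ k))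
  same-slope (inj₁ (c , n′≡)) = sym (trans (cong (λ x → totalSlope k (suc (x ∸ k))) n′≡) (slope-+ n c k≤n))
  same-slope (inj₂ (c , n≡))  = trans (cong (λ x → totalSlope k (suc (x ∸ k))) n≡) (slope-+ n′ c k≤n′)
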